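{- If $S$ is an extreme ray of $H_n$, then its zero-lift $S'$ is an extreme ray of $H_{n+1}$. Hence $H_n$ is a projection of $H_{n+1}$ (namely onto the coordinates $S_I$ with $\varnothing\ne I\subseteq[n]$).
   Context: For a positive integer $k$ let $[k]=\{1,\dots,k\}$. $K_N$ is the undirected complete graph on vertex set $[N]$, with edge set $E_N=\{(i,j):1\le i<j\le N\}$. A weight map is a function $w:E_N\to\mathbb{R}_{\ge 0}$. For $W\subseteq[N]$, the cut $C(W)$ is the set of edges with exactly one endpoint in $W$, and $\|C(W)\|$ is the sum of the weights of its edges. For $1\le n<N$, a weight map $w$ on $K_N$ realizes in $K_N$ the vector $S=(S_I)_{\varnothing\ne I\subseteq[n]}\in\mathbb{R}^{2^n-1}$ with $S_I=\min\{\|C(W)\| : W\subseteq[N-1],\ W\cap[n]=I\}$. $H_n$ is the set of all $S\in\mathbb{R}^{2^n-1}$ realized by some weight map in $K_N$ for some $N>n$; it is a convex polyhedral cone. Extreme rays are identified with their nonzero generating vectors up to positive scaling. The zero-lift of $S\in\mathbb{R}^{2^n-1}$ is the vector $S'\in\mathbb{R}^{2^{n+1}-1}$ with $S'_{\{n+1\}}=0$ and $S'_{I\cup\{n+1\}}=S'_I=S_I$ for all $\varnothing\ne I\subseteq[n]$. -}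

module Defs where

open import Algebra.Bundles.Raw using (RawMonoid)
import Algebra.Definitions.RawMonoid as RawMonoidDefinitions
open import Data.Bool.Base using (Bool; if_then_else_; _xor_)
open import Data.Fin.Base as Fin using (Fin)
import Data.Fin.Properties as Fin
open import Data.Fin.Subset using (Subset; inside; outside; _∈_; Nonempty)
open import Data.Fin.Subset.Properties using (nonempty?)
open import Data.Nat.Base as ℕ using (ℕ; zero; suc)
import Data.Nat.Properties as ℕ
open import Data.Product.Base using (Σ-syntax; ∃; ∃-syntax; _×_; _,_; proj₁; proj₂)
open import Data.Rational.Base as ℚ
  using (ℚ; 0ℚ; 1ℚ; ½; Positive; NonNegative; ∣_∣; _⊓_)
import Data.Rational.Properties as ℚ
open import Data.Rational.Solver using (module +-*-Solver)
open import Data.Sum.Base using (inj₁; inj₂)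
open import Data.Vec.Base using ([]; _∷_; _++_; _∷ʳ_; here; there; lookup; init)
open import Level using (0ℓ)
open import Relation.Binary.PropositionalEquality
  using (_≡_; refl; sym; trans; cong; subst; subst₂)
open import Relation.Nullary.Decidable.Core using (yes; no)
open import Relation.Nullary.Negation.Core using (¬_)

------------------------------------------------------------------------
-- Real numbers, as Cauchy sequences of rationals

private
  open +-*-Solver

  triangle : ∀ p q r {ε δ} → p ≡ q ℚ.+ r → ∣ q ∣ ℚ.< ε → ∣ r ∣ ℚ.< δ → ∣ p ∣ ℚ.< ε ℚ.+ δ
  triangle _ q r refl q<ε r<δ =
    ℚ.≤-<-trans (ℚ.∣p+q∣≤∣p∣+∣q∣ q r) (ℚ.+-mono-< q<ε r<δ)

  half+half : ∀ ε → ½ ℚ.* ε ℚ.+ ½ ℚ.* ε ≡ ε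
  half+half ε = trans (sym (ℚ.*-distribʳ-+ ε ½ ½)) (ℚ.*-identityˡ ε)

  half-pos : ∀ {ε} → 0ℚ ℚ.< ε → 0ℚ ℚ.< ½ ℚ.* ε
  half-pos 0<ε = ℚ.*-monoʳ-<-pos ½ 0<ε

  p≤∣p∣ : ∀ p → p ℚ.≤ ∣ p ∣
  p≤∣p∣ p with ℚ.≤-total 0ℚ p
  ... | inj₁ 0≤p = ℚ.≤-reflexive (sym (ℚ.0≤p⇒∣p∣≡p 0≤p))
  ... | inj₂ p≤0 = ℚ.≤-trans p≤0 (ℚ.0≤∣p∣ p)

  diff-swap : ∀ p q → ∣ p ℚ.- q ∣ ≡ ∣ q ℚ.- p ∣
  diff-swap p q = trans
    (cong ∣_∣ (solve 2 (λ p q → p :- q := :- (q :- p)) refl p q))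
    (ℚ.∣-p∣≡∣p∣ (q ℚ.- p))

  diff⇒< : ∀ p q {ε} → ∣ p ℚ.- q ∣ ℚ.< ε → p ℚ.< q ℚ.+ ε
  diff⇒< p q {ε} d = subst (ℚ._< q ℚ.+ ε)
    (solve 2 (λ p q → q :+ (p :- q) := p) refl p q)
    (ℚ.+-monoʳ-< q (ℚ.≤-<-trans (p≤∣p∣ (p ℚ.- q)) d))

  <⇒diff : ∀ p q {ε} → p ℚ.< q ℚ.+ ε → q ℚ.< p ℚ.+ ε → ∣ p ℚ.- q ∣ ℚ.< ε
  <⇒diff p q {ε} p< q< with ℚ.∣p∣≡p∨∣p∣≡-p (p ℚ.- q)
  ... | inj₁ eq = subst₂ ℚ._<_ (sym eq)
          (solve 2 (λ q e → q :+ e :- q := e) refl q ε) (ℚ.+-monoˡ-< (ℚ.- q) p<)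
  ... | inj₂ eq = subst₂ ℚ._<_
          (trans (solve 2 (λ p q → q :- p := :- (p :- q)) refl p q) (sym eq))
          (solve 2 (λ p e → p :+ e :- p := e) refl p ε) (ℚ.+-monoˡ-< (ℚ.- p) q<)

  ⊓-< : ∀ p q r s {ε} → p ℚ.< r ℚ.+ ε → q ℚ.< s ℚ.+ ε → p ⊓ q ℚ.< (r ⊓ s) ℚ.+ ε
  ⊓-< p q r s {ε} p< q< with ℚ.⊓-sel r s
  ... | inj₁ eq = subst (λ z → p ⊓ q ℚ.< z ℚ.+ ε) (sym eq) (ℚ.≤-<-trans (ℚ.p⊓q≤p p q) p<)
  ... | inj₂ eq = subst (λ z → p ⊓ q ℚ.< z ℚ.+ ε) (sym eq) (ℚ.≤-<-trans (ℚ.p⊓q≤q p q) q<)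

  ⊓-diff : ∀ p q r s {ε} → ∣ p ℚ.- r ∣ ℚ.< ε → ∣ q ℚ.- s ∣ ℚ.< ε →
           ∣ (p ⊓ q) ℚ.- (r ⊓ s) ∣ ℚ.< ε
  ⊓-diff p q r s {ε} d e = <⇒diff (p ⊓ q) (r ⊓ s)
    (⊓-< p q r s (diff⇒< p r d) (diff⇒< q s e))
    (⊓-< r s p q (diff⇒< r p (subst (ℚ._< ε) (diff-swap p r) d))
                 (diff⇒< s q (subst (ℚ._< ε) (diff-swap q s) e)))

IsCauchy : (ℕ → ℚ) → Set
IsCauchy x = ∀ ε → 0ℚ ℚ.< ε →
  ∃[ N ] (∀ m n → N ℕ.≤ m → N ℕ.≤ n → ∣ x m ℚ.- x n ∣ ℚ.< ε)

record ℝ : Set where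
  constructor mkℝ
  field
    seq    : ℕ → ℚ
    cauchy : IsCauchy seq

open ℝ public

infix 4 _≈ℝ_ _≤ℝ_

_≈ℝ_ : ℝ → ℝ → Set
x ≈ℝ y = ∀ ε → 0ℚ ℚ.< ε →
  ∃[ N ] (∀ n → N ℕ.≤ n → ∣ seq x n ℚ.- seq y n ∣ ℚ.< ε)

_≤ℝ_ : ℝ → ℝ → Set
x ≤ℝ y = ∀ ε → 0ℚ ℚ.< ε →
  ∃[ N ] (∀ n → N ℕ.≤ n → seq x n ℚ.< seq y n ℚ.+ ε)

0ℝ : ℝ
0ℝ = mkℝ (λ _ → 0ℚ) (λ ε 0<ε → 0 , λ _ _ _ _ → 0<ε)

infixl 6 _+ℝ_
infixl 7 _*ℝ_ _⊓ℝ_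

_+ℝ_ : ℝ → ℝ → ℝ
x +ℝ y = mkℝ (λ n → seq x n ℚ.+ seq y n) λ ε 0<ε →
  let (M , p) = cauchy x (½ ℚ.* ε) (half-pos 0<ε)
      (N , q) = cauchy y (½ ℚ.* ε) (half-pos 0<ε)
  in M ℕ.⊔ N , λ m n ≤m ≤n → subst (∣ (seq x m ℚ.+ seq y m) ℚ.- (seq x n ℚ.+ seq y n) ∣ ℚ.<_) (half+half ε)
       (triangle _ (seq x m ℚ.- seq x n) (seq y m ℚ.- seq y n)
         (solve 4 (λ a b c d → (a :+ b) :- (c :+ d) := (a :- c) :+ (b :- d)) refl
           (seq x m) (seq y m) (seq x n) (seq y n))
         (p m n (ℕ.m⊔n≤o⇒m≤o M N ≤m) (ℕ.m⊔n≤o⇒m≤o M N ≤n))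
         (q m n (ℕ.m⊔n≤o⇒n≤o M N ≤m) (ℕ.m⊔n≤o⇒n≤o M N ≤n)))

_⊓ℝ_ : ℝ → ℝ → ℝ
x ⊓ℝ y = mkℝ (λ n → seq x n ⊓ seq y n) λ ε 0<ε →
  let (M , p) = cauchy x ε 0<ε
      (N , q) = cauchy y ε 0<ε
  in M ℕ.⊔ N , λ m n ≤m ≤n → ⊓-diff (seq x m) (seq y m) (seq x n) (seq y n)
       (p m n (ℕ.m⊔n≤o⇒m≤o M N ≤m) (ℕ.m⊔n≤o⇒m≤o M N ≤n))
       (q m n (ℕ.m⊔n≤o⇒n≤o M N ≤m) (ℕ.m⊔n≤o⇒n≤o M N ≤n))

private
  EventuallyBounded : (ℕ → ℚ) → Set
  EventuallyBounded x = ∃[ B ] Positive B × ∃[ N ] (∀ n → N ℕ.≤ n → ∣ x n ∣ ℚ.≤ B)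

  cauchy⇒bounded : ∀ x → IsCauchy x → EventuallyBounded x
  cauchy⇒bounded x c =
    let (N , p) = c 1ℚ (ℚ.positive⁻¹ 1ℚ)
        instance
          nn : NonNegative ∣ x N ∣
          nn = ℚ.∣-∣-nonNeg (x N)
    in 1ℚ ℚ.+ ∣ x N ∣ , ℚ.pos+nonNeg⇒pos 1ℚ ∣ x N ∣ , N , λ n N≤n →
         subst (λ z → ∣ z ∣ ℚ.≤ 1ℚ ℚ.+ ∣ x N ∣)
           (solve 2 (λ a b → (a :- b) :+ b := a) refl (x n) (x N))
           (ℚ.≤-trans (ℚ.∣p+q∣≤∣p∣+∣q∣ (x n ℚ.- x N) (x N))
             (ℚ.+-monoˡ-≤ ∣ x N ∣ (ℚ.<⇒≤ (p n N N≤n ℕ.≤-refl))))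

  scaled : ∀ B → .{{_ : Positive B}} → ∀ p q {ε} → ∣ p ∣ ℚ.≤ B →
           ∣ q ∣ ℚ.< (ℚ.1/ B) {{ℚ.pos⇒nonZero B}} ℚ.* ε → ∣ p ℚ.* q ∣ ℚ.< ε
  scaled B p q {ε} p≤B q< = ℚ.≤-<-trans
    (subst (ℚ._≤ B ℚ.* ∣ q ∣) (sym (ℚ.∣p*q∣≡∣p∣*∣q∣ p q))
      (ℚ.*-monoʳ-≤-nonNeg ∣ q ∣ {{ℚ.∣-∣-nonNeg q}} p≤B))
    (subst (B ℚ.* ∣ q ∣ ℚ.<_) cancel (ℚ.*-monoʳ-<-pos B q<))
    where
    instance
      nz = ℚ.pos⇒nonZero B
    cancel : B ℚ.* (ℚ.1/ B ℚ.* ε) ≡ ε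
    cancel = trans (sym (ℚ.*-assoc B (ℚ.1/ B) ε))
      (trans (cong (ℚ._* ε) (ℚ.*-inverseʳ B)) (ℚ.*-identityˡ ε))

  scaled-pos : ∀ B → .{{_ : Positive B}} → ∀ {ε} → 0ℚ ℚ.< ε →
               0ℚ ℚ.< (ℚ.1/ B) {{ℚ.pos⇒nonZero B}} ℚ.* ε
  scaled-pos B {ε} 0<ε = subst (ℚ._< r ℚ.* ε) (ℚ.*-zeroʳ r)
    (ℚ.*-monoʳ-<-pos r {{ℚ.1/pos⇒pos B}} 0<ε)
    where
    r = (ℚ.1/ B) {{ℚ.pos⇒nonZero B}}

  product-diff : ∀ a b c d → a ℚ.* b ℚ.- c ℚ.* d ≡ a ℚ.* (b ℚ.- d) ℚ.+ d ℚ.* (a ℚ.- c)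
  product-diff = solve 4
    (λ a b c d → a :* b :- c :* d := a :* (b :- d) :+ d :* (a :- c)) refl

  *-cauchy : ∀ x y → IsCauchy x → IsCauchy y → IsCauchy (λ n → x n ℚ.* y n)
  *-cauchy x y cx cy ε 0<ε = k , bound
    where
    B = proj₁ (cauchy⇒bounded x cx)
    C = proj₁ (cauchy⇒bounded y cy)
    instance
      B>0 : Positive B
      B>0 = proj₁ (proj₂ (cauchy⇒bounded x cx))
      C>0 : Positive C
      C>0 = proj₁ (proj₂ (cauchy⇒bounded y cy))
    boundx = proj₂ (proj₂ (cauchy⇒bounded x cx))
    boundy = proj₂ (proj₂ (cauchy⇒bounded y cy))
    closex = cx ((ℚ.1/ C) {{ℚ.pos⇒nonZero C}} ℚ.* (½ ℚ.* ε)) (scaled-pos C (half-pos 0<ε))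
    closey = cy ((ℚ.1/ B) {{ℚ.pos⇒nonZero B}} ℚ.* (½ ℚ.* ε)) (scaled-pos B (half-pos 0<ε))
    K = proj₁ boundx
    L = proj₁ boundy
    M = proj₁ closex
    N = proj₁ closey
    k = (K ℕ.⊔ L) ℕ.⊔ (M ℕ.⊔ N)
    K≤ : K ℕ.≤ k
    K≤ = ℕ.≤-trans (ℕ.m≤m⊔n K L) (ℕ.m≤m⊔n (K ℕ.⊔ L) (M ℕ.⊔ N))
    L≤ : L ℕ.≤ k
    L≤ = ℕ.≤-trans (ℕ.m≤n⊔m K L) (ℕ.m≤m⊔n (K ℕ.⊔ L) (M ℕ.⊔ N))
    M≤ : M ℕ.≤ k
    M≤ = ℕ.≤-trans (ℕ.m≤m⊔n M N) (ℕ.m≤n⊔m (K ℕ.⊔ L) (M ℕ.⊔ N))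
    N≤ : N ℕ.≤ k
    N≤ = ℕ.≤-trans (ℕ.m≤n⊔m M N) (ℕ.m≤n⊔m (K ℕ.⊔ L) (M ℕ.⊔ N))
    bound : ∀ m n → k ℕ.≤ m → k ℕ.≤ n → ∣ x m ℚ.* y m ℚ.- x n ℚ.* y n ∣ ℚ.< ε
    bound m n ≤m ≤n = subst (∣ x m ℚ.* y m ℚ.- x n ℚ.* y n ∣ ℚ.<_) (half+half ε)
      (triangle _ (x m ℚ.* (y m ℚ.- y n)) (y n ℚ.* (x m ℚ.- x n))
        (product-diff (x m) (y m) (x n) (y n))
        (scaled B (x m) (y m ℚ.- y n) (proj₂ boundx m (ℕ.≤-trans K≤ ≤m))
          (proj₂ closey m n (ℕ.≤-trans N≤ ≤m) (ℕ.≤-trans N≤ ≤n)))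
        (scaled C (y n) (x m ℚ.- x n) (proj₂ boundy n (ℕ.≤-trans L≤ ≤n))
          (proj₂ closex m n (ℕ.≤-trans M≤ ≤m) (ℕ.≤-trans M≤ ≤n))))

_*ℝ_ : ℝ → ℝ → ℝ
x *ℝ y = mkℝ (λ n → seq x n ℚ.* seq y n) (*-cauchy (seq x) (seq y) (cauchy x) (cauchy y))

+ℝ-0-rawMonoid : RawMonoid 0ℓ 0ℓ
+ℝ-0-rawMonoid = record { Carrier = ℝ ; _≈_ = _≈ℝ_ ; _∙_ = _+ℝ_ ; ε = 0ℝ }

open RawMonoidDefinitions +ℝ-0-rawMonoid public using (sum)

------------------------------------------------------------------------
-- Weighted complete graphs and cuts

-- Irrelevance of `i<j` makes an edge determined by its endpoints.
record Edge (N : ℕ) : Set where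
  constructor edge
  field
    i j  : Fin N
    .i<j : i Fin.< j

record WeightMap (N : ℕ) : Set where
  field
    weight : Edge N → ℝ
    weight≥0 : ∀ e → 0ℝ ≤ℝ weight e

open WeightMap public

extendBy0 : ∀ {N} → (Edge N → ℝ) → Fin N → Fin N → ℝ
extendBy0 f i j with i Fin.<? j
... | yes i<j = f (edge i j i<j)
... | no  _   = 0ℝ

∑edges : ∀ {N} → (Edge N → ℝ) → ℝ
∑edges f = sum λ i → sum λ j → extendBy0 f i j

_∈C_ : ∀ {N} → Edge N → Subset N → Bool
edge i j _ ∈C W = lookup W i xor lookup W j

‖C‖ : ∀ {N} → WeightMap N → Subset N → ℝ
‖C‖ w W = ∑edges λ e → if e ∈C W then weight w e else 0ℝ

⨅ : ∀ {m} → (Subset m → ℝ) → ℝ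
⨅ {zero}  f = f []
⨅ {suc m} f = ⨅ (λ T → f (outside ∷ T)) ⊓ℝ ⨅ (λ T → f (inside ∷ T))

-- N = n + suc m ranges over all N > n.  The sets W ⊆ [N-1] with W ∩ [n] = I
-- are the concatenations of I, of an arbitrary subset T of the m vertices
-- n+1, …, N-1, and of the entry `outside` for the vertex N.
minCut : ∀ {n m} → WeightMap (n ℕ.+ suc m) → Subset n → ℝ
minCut w I = ⨅ λ T → ‖C‖ w (I ++ (T ∷ʳ outside))

------------------------------------------------------------------------
-- The space ℝ^(2ⁿ-1), indexed by the nonempty subsets of [n]

-- Irrelevance of the nonemptiness proof makes a coordinate depend on I only.
Vector : ℕ → Set
Vector n = (I : Subset n) → .(Nonempty I) → ℝ

infix  4 _≋_
infixl 6 _⊕_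
infixr 7 _·_

_≋_ : ∀ {n} → Vector n → Vector n → Set
S ≋ T = ∀ I .(I≢∅ : Nonempty I) → S I I≢∅ ≈ℝ T I I≢∅

𝟎 : ∀ {n} → Vector n
𝟎 _ _ = 0ℝ

_⊕_ : ∀ {n} → Vector n → Vector n → Vector n
(S ⊕ T) I I≢∅ = S I I≢∅ +ℝ T I I≢∅

_·_ : ∀ {n} → ℝ → Vector n → Vector n
(c · S) I I≢∅ = c *ℝ S I I≢∅

Realizes : ∀ {n m} → WeightMap (n ℕ.+ suc m) → Vector n → Set
Realizes {n} {m} w S = ∀ I .(I≢∅ : Nonempty I) → S I I≢∅ ≈ℝ minCut {n} {m} w I

H : ∀ n → Vector n → Set
H n S = ∃[ m ] Σ[ w ∈ WeightMap (n ℕ.+ suc m) ] Realizes {n} {m} w S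

_∈ray_ : ∀ {n} → Vector n → Vector n → Set
A ∈ray S = ∃[ c ] 0ℝ ≤ℝ c × A ≋ c · S

record IsExtremeRay {n} (K : Vector n → Set) (S : Vector n) : Set where
  field
    member  : K S
    nonzero : ¬ S ≋ 𝟎
    extreme : ∀ A B → K A → K B → S ≋ A ⊕ B → A ∈ray S × B ∈ray S

-- For J ⊆ [n+1], `init J` is J ∩ [n].  It is empty, for nonempty J,
-- exactly when J = {n+1}.
zeroLift : ∀ {n} → Vector n → Vector (suc n)
zeroLift S J _ with nonempty? (init J)
... | yes I≢∅ = S (init J) I≢∅
... | no  _   = 0ℝ

Nonempty-∷ʳ : ∀ {n} {I : Subset n} b → Nonempty I → Nonempty (I ∷ʳ b)
Nonempty-∷ʳ b (x , x∈I) = Fin.inject₁ x , go x∈I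
  where
  go : ∀ {n} {x : Fin n} {I : Subset n} → x ∈ I → Fin.inject₁ x ∈ (I ∷ʳ b)
  go here        = here
  go (there x∈I) = there (go x∈I)

-- The coordinate projection ℝ^(2ⁿ⁺¹-1) → ℝ^(2ⁿ-1): `I ∷ʳ outside` is I as a
-- subset of [n+1].
project : ∀ {n} → Vector (suc n) → Vector n
project S I I≢∅ = S (I ∷ʳ outside) (Nonempty-∷ʳ outside I≢∅)

Image : ∀ {n k} → (Vector n → Vector k) → (Vector n → Set) → Vector k → Set
Image f K T = ∃[ S ] K S × f S ≋ T

{-# OPTIONS --safe #-}

-- Pushing a weight map forward along a map g of vertices preserves cuts: the
-- set W cuts the image exactly as its preimage under g cuts the original.
-- Adding an isolated terminal n+1 therefore realizes the zero-lift, and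
-- contracting the terminal n+1 into the sink N realizes the projection.
--
-- For extremality, S' = A + B forces A_{n+1} = B_{n+1} = 0.  Cuts are subadditive
-- under symmetric difference, so A_J and A_{J △ {n+1}} differ by at most
-- A_{n+1}; hence A and B are the zero-lifts of their projections, and the
-- decomposition of S' is the lift of a decomposition of S.
module Submission where

open import Defs
open import Algebra.Bundles using (CommutativeMonoid; CommutativeRing)
open import Data.Bool.Base using (Bool; true; false; if_then_else_; _xor_)
open import Data.Bool.Properties using (xor-comm; xor-same; xor-identityʳ; xor-∧-commutativeRing)
open import Data.Fin.Base as Fin using (Fin; zero; suc)
import Data.Fin.Properties as Fin
open import Data.Fin.Subset using (Subset; inside; outside; Nonempty; ⊥)
open import Data.Fin.Subset.Properties using (nonempty?; Empty-unique; ∉⊥)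
open import Data.Nat.Base as ℕ using (ℕ; zero; suc; NonZero)
import Data.Nat.Properties as ℕ
open import Data.Product.Base using (∃-syntax; _×_; _,_; proj₂)
open import Data.Rational.Base as ℚ using (ℚ; 0ℚ; ½)
import Data.Rational.Properties as ℚ
open import Data.Rational.Solver using (module +-*-Solver)
open import Data.Sum.Base using (inj₁; inj₂)
open import Data.Vec.Base
  using ([]; _∷_; _++_; _∷ʳ_; here; there; lookup; init; last; initLast; zipWith)
open import Data.Vec.Properties
  using (lookup-zipWith; lookup-replicate; zipWith-++; zipWith-identityʳ; init-∷ʳ)
open import Function.Base using (_∘_; flip)
open import Function.Bundles using (_⇔_; mk⇔)
open import Level using (0ℓ)
open import Relation.Binary.Bundles using (Poset)
open import Relation.Binary.PropositionalEquality
  using (_≡_; refl; sym; trans; cong; cong₂; subst; subst₂)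
import Relation.Binary.Reasoning.PartialOrder as PosetReasoning
import Relation.Binary.Reasoning.Setoid as SetoidReasoning
open import Relation.Nullary.Decidable.Core using (yes; no; does)
open import Relation.Nullary.Negation.Core using (contradiction; contradiction-irr; ¬_)

-- Ordered additive structure of ℝ

private
  Eventually : (ℕ → Set) → Set
  Eventually P = ∃[ N ] (∀ n → N ℕ.≤ n → P n)

  always : ∀ {P} → (∀ n → P n) → Eventually P
  always p = 0 , λ n _ → p n

  zipEventually : ∀ {P Q R : ℕ → Set} → (∀ n → P n → Q n → R n) →
                  Eventually P → Eventually Q → Eventually R
  zipEventually f (M , p) (N , q) = M ℕ.⊔ N , λ n ≤n →
    f n (p n (ℕ.m⊔n≤o⇒m≤o M N ≤n)) (q n (ℕ.m⊔n≤o⇒n≤o M N ≤n))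

  ½-pos : ∀ {ε} → 0ℚ ℚ.< ε → 0ℚ ℚ.< ½ ℚ.* ε
  ½-pos 0<ε = ℚ.*-monoʳ-<-pos ½ 0<ε

  ½+½ : ∀ ε → ½ ℚ.* ε ℚ.+ ½ ℚ.* ε ≡ ε
  ½+½ ε = trans (sym (ℚ.*-distribʳ-+ ε ½ ½)) (ℚ.*-identityˡ ε)

  p<p+ε : ∀ p {ε} → 0ℚ ℚ.< ε → p ℚ.< p ℚ.+ ε
  p<p+ε p {ε} 0<ε = subst (ℚ._< p ℚ.+ ε) (ℚ.+-identityʳ p) (ℚ.+-monoʳ-< p 0<ε)

  p-q<ε⇒p<q+ε : ∀ p q {ε} → p ℚ.- q ℚ.< ε → p ℚ.< q ℚ.+ ε
  p-q<ε⇒p<q+ε p q {ε} d = subst (ℚ._< q ℚ.+ ε)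
    (solve 2 (λ p q → q :+ (p :- q) := p) refl p q) (ℚ.+-monoʳ-< q d)
    where open +-*-Solver

  p<q+ε⇒p-q<ε : ∀ p q {ε} → p ℚ.< q ℚ.+ ε → p ℚ.- q ℚ.< ε
  p<q+ε⇒p-q<ε p q {ε} p< = subst (p ℚ.- q ℚ.<_)
    (solve 2 (λ q ε → q :+ ε :- q := ε) refl q ε) (ℚ.+-monoˡ-< (ℚ.- q) p<)
    where open +-*-Solver

  p≤∣p∣ : ∀ p → p ℚ.≤ ℚ.∣ p ∣
  p≤∣p∣ p with ℚ.≤-total 0ℚ p
  ... | inj₁ 0≤p = ℚ.≤-reflexive (sym (ℚ.0≤p⇒∣p∣≡p 0≤p))
  ... | inj₂ p≤0 = ℚ.≤-trans p≤0 (ℚ.0≤∣p∣ p)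

  -[p-q] : ∀ p q → ℚ.- (p ℚ.- q) ≡ q ℚ.- p
  -[p-q] = solve 2 (λ p q → :- (p :- q) := q :- p) refl
    where open +-*-Solver

  ∣p-q∣≡∣q-p∣ : ∀ p q → ℚ.∣ p ℚ.- q ∣ ≡ ℚ.∣ q ℚ.- p ∣
  ∣p-q∣≡∣q-p∣ p q = trans (sym (ℚ.∣-p∣≡∣p∣ (p ℚ.- q))) (cong ℚ.∣_∣ (-[p-q] p q))

  ∣p-q∣<ε : ∀ p q {ε} → p ℚ.< q ℚ.+ ε → q ℚ.< p ℚ.+ ε → ℚ.∣ p ℚ.- q ∣ ℚ.< ε
  ∣p-q∣<ε p q {ε} p< q< with ℚ.∣p∣≡p∨∣p∣≡-p (p ℚ.- q)
  ... | inj₁ eq = subst (ℚ._< ε) (sym eq) (p<q+ε⇒p-q<ε p q p<)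
  ... | inj₂ eq = subst (ℚ._< ε) (sym (trans eq (-[p-q] p q))) (p<q+ε⇒p-q<ε q p q<)

-- _≈ℝ_ and _≤ℝ_ unfold to function types, from which x and y cannot be inferred.
infix 4 _≈_ _≤_

record _≈_ (x y : ℝ) : Set where
  constructor ⟨_⟩
  field to≈ℝ : x ≈ℝ y

record _≤_ (x y : ℝ) : Set where
  constructor ⟨_⟩
  field to≤ℝ : x ≤ℝ y

open _≈_
open _≤_

pointwise-≤ : ∀ {x y} → (∀ n → seq x n ℚ.≤ seq y n) → x ≤ y
pointwise-≤ {x} {y} x≤y = ⟨ (λ ε 0<ε → always λ n → ℚ.≤-<-trans (x≤y n) (p<p+ε (seq y n) 0<ε)) ⟩

≤-antisym : ∀ {x y} → x ≤ y → y ≤ x → x ≈ y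
≤-antisym {x} {y} ⟨ x≤y ⟩ ⟨ y≤x ⟩ = ⟨ (λ ε 0<ε →
  zipEventually (λ n → ∣p-q∣<ε (seq x n) (seq y n)) (x≤y ε 0<ε) (y≤x ε 0<ε)) ⟩

pointwise-≈ : ∀ {x y} → (∀ n → seq x n ≡ seq y n) → x ≈ y
pointwise-≈ x≡y = ≤-antisym (pointwise-≤ λ n → ℚ.≤-reflexive (x≡y n))
                            (pointwise-≤ λ n → ℚ.≤-reflexive (sym (x≡y n)))

≤-reflexive : ∀ {x y} → x ≈ y → x ≤ y
≤-reflexive {x} {y} ⟨ x≈y ⟩ = ⟨ (λ ε 0<ε → let (N , d) = x≈y ε 0<ε in
  N , λ n N≤n → p-q<ε⇒p<q+ε (seq x n) (seq y n)
    (ℚ.≤-<-trans (p≤∣p∣ (seq x n ℚ.- seq y n)) (d n N≤n))) ⟩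

≈-refl : ∀ {x} → x ≈ x
≈-refl = pointwise-≈ λ _ → refl

≤-refl : ∀ {x} → x ≤ x
≤-refl = ≤-reflexive ≈-refl

≡⇒≈ : ∀ {x y} → x ≡ y → x ≈ y
≡⇒≈ refl = ≈-refl

≈-sym : ∀ {x y} → x ≈ y → y ≈ x
≈-sym {x} {y} ⟨ x≈y ⟩ = ⟨ (λ ε 0<ε → let (N , d) = x≈y ε 0<ε in
  N , λ n N≤n → subst (ℚ._< ε) (∣p-q∣≡∣q-p∣ (seq x n) (seq y n)) (d n N≤n)) ⟩

≤-trans : ∀ {x y z} → x ≤ y → y ≤ z → x ≤ z
≤-trans {x} {y} {z} ⟨ x≤y ⟩ ⟨ y≤z ⟩ = ⟨ (λ ε 0<ε →
  zipEventually (step ε) (x≤y _ (½-pos 0<ε)) (y≤z _ (½-pos 0<ε))) ⟩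
  where
  step : ∀ ε n → seq x n ℚ.< seq y n ℚ.+ ½ ℚ.* ε → seq y n ℚ.< seq z n ℚ.+ ½ ℚ.* ε →
         seq x n ℚ.< seq z n ℚ.+ ε
  step ε n x< y< = subst (seq x n ℚ.<_)
    (trans (ℚ.+-assoc (seq z n) _ _) (cong (seq z n ℚ.+_) (½+½ ε)))
    (ℚ.<-trans x< (ℚ.+-monoˡ-< (½ ℚ.* ε) y<))

≈-trans : ∀ {x y z} → x ≈ y → y ≈ z → x ≈ z
≈-trans x≈y y≈z = ≤-antisym (≤-trans (≤-reflexive x≈y) (≤-reflexive y≈z))
  (≤-trans (≤-reflexive (≈-sym y≈z)) (≤-reflexive (≈-sym x≈y)))

+ℝ-mono-≤ : ∀ {x y u v} → x ≤ y → u ≤ v → x +ℝ u ≤ y +ℝ v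
+ℝ-mono-≤ {x} {y} {u} {v} ⟨ x≤y ⟩ ⟨ u≤v ⟩ = ⟨ (λ ε 0<ε →
  zipEventually (step ε) (x≤y _ (½-pos 0<ε)) (u≤v _ (½-pos 0<ε))) ⟩
  where
  open +-*-Solver
  step : ∀ ε n → seq x n ℚ.< seq y n ℚ.+ ½ ℚ.* ε → seq u n ℚ.< seq v n ℚ.+ ½ ℚ.* ε →
         seq x n ℚ.+ seq u n ℚ.< seq y n ℚ.+ seq v n ℚ.+ ε
  step ε n x< u< = subst (seq x n ℚ.+ seq u n ℚ.<_)
    (trans (solve 3 (λ y v h → (y :+ h) :+ (v :+ h) := (y :+ v) :+ (h :+ h)) refl
             (seq y n) (seq v n) (½ ℚ.* ε))
           (cong (seq y n ℚ.+ seq v n ℚ.+_) (½+½ ε)))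
    (ℚ.+-mono-< x< u<)

≤-poset : Poset 0ℓ 0ℓ 0ℓ
≤-poset = record
  { Carrier = ℝ ; _≈_ = _≈_ ; _≤_ = _≤_
  ; isPartialOrder = record
    { isPreorder = record
      { isEquivalence = record { refl = ≈-refl ; sym = ≈-sym ; trans = ≈-trans }
      ; reflexive = ≤-reflexive
      ; trans     = ≤-trans
      }
    ; antisym = ≤-antisym
    }
  }

+ℝ-0-commutativeMonoid : CommutativeMonoid 0ℓ 0ℓ
+ℝ-0-commutativeMonoid = record
  { Carrier = ℝ ; _≈_ = _≈_ ; _∙_ = _+ℝ_ ; ε = 0ℝ
  ; isCommutativeMonoid = record
    { isMonoid = record
      { isSemigroup = record
        { isMagma = record
          { isEquivalence = Poset.isEquivalence ≤-poset
          ; ∙-cong = λ {x} {y} {u} {v} x≈y u≈v → ≤-antisym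
              (+ℝ-mono-≤ {x} {y} {u} {v} (≤-reflexive x≈y) (≤-reflexive u≈v))
              (+ℝ-mono-≤ {y} {x} {v} {u} (≤-reflexive (≈-sym x≈y)) (≤-reflexive (≈-sym u≈v)))
          }
        ; assoc = λ x y z → pointwise-≈ λ n → ℚ.+-assoc (seq x n) (seq y n) (seq z n)
        }
      ; identity = (λ x → pointwise-≈ λ n → ℚ.+-identityˡ (seq x n))
                 , (λ x → pointwise-≈ λ n → ℚ.+-identityʳ (seq x n))
      }
    ; comm = λ x y → pointwise-≈ λ n → ℚ.+-comm (seq x n) (seq y n)
    }
  }

open CommutativeMonoid +ℝ-0-commutativeMonoid
  using (setoid)
open import Algebra.Properties.CommutativeMonoid.Sum +ℝ-0-commutativeMonoid
  using (sum-cong-≋; sum-replicate-zero; ∑-comm)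

module ≈-Reasoning = SetoidReasoning setoid
module ≤-Reasoning = PosetReasoning ≤-poset

-- Unfolding _+ℝ_ exposes its proof of the Cauchy property, whose normalisation
-- is prohibitively expensive.
infixl 6 _+_

opaque
  _+_ : ℝ → ℝ → ℝ
  _+_ = _+ℝ_

  +≈+ℝ : ∀ x y → x + y ≈ x +ℝ y
  +≈+ℝ x y = pointwise-≈ λ _ → refl

  +-mono-≤ : ∀ {x y u v} → x ≤ y → u ≤ v → x + u ≤ y + v
  +-mono-≤ {x} {y} {u} {v} = +ℝ-mono-≤ {x} {y} {u} {v}

  +-identityˡ : ∀ x → 0ℝ + x ≈ x
  +-identityˡ x = pointwise-≈ λ n → ℚ.+-identityˡ (seq x n)

  +-identityʳ : ∀ x → x + 0ℝ ≈ x
  +-identityʳ x = pointwise-≈ λ n → ℚ.+-identityʳ (seq x n)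

  +-comm : ∀ x y → x + y ≈ y + x
  +-comm x y = pointwise-≈ λ n → ℚ.+-comm (seq x n) (seq y n)

  +-interchange : ∀ x y u v → (x + y) + (u + v) ≈ (x + u) + (y + v)
  +-interchange x y u v = pointwise-≈ λ n →
    solve 4 (λ x y u v → (x :+ y) :+ (u :+ v) := (x :+ u) :+ (y :+ v)) refl
      (seq x n) (seq y n) (seq u n) (seq v n)
    where open +-*-Solver

  -- At each index the rational minimum is one of its two arguments, so the bound for that argument
  -- applies. The offset `u` lets an infimum be bounded while it stands inside a sum.
  ⊓-+-glb : ∀ {x y z u} → x ≤ y + u → x ≤ z + u → x ≤ (y ⊓ℝ z) + u
  ⊓-+-glb {x} {y} {z} {u} ⟨ x≤y ⟩ ⟨ x≤z ⟩ = ⟨ (λ ε 0<ε →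
    zipEventually (step ε) (x≤y ε 0<ε) (x≤z ε 0<ε)) ⟩
    where
    step : ∀ ε n → seq x n ℚ.< seq y n ℚ.+ seq u n ℚ.+ ε →
           seq x n ℚ.< seq z n ℚ.+ seq u n ℚ.+ ε →
           seq x n ℚ.< (seq y n ℚ.⊓ seq z n) ℚ.+ seq u n ℚ.+ ε
    step ε n y< z< with ℚ.⊓-sel (seq y n) (seq z n)
    ... | inj₁ eq = subst (λ w → seq x n ℚ.< w ℚ.+ seq u n ℚ.+ ε) (sym eq) y<
    ... | inj₂ eq = subst (λ w → seq x n ℚ.< w ℚ.+ seq u n ℚ.+ ε) (sym eq) z<

  sum-suc : ∀ {n} (f : Fin (suc n) → ℝ) → sum f ≈ f zero + sum (f ∘ suc)
  sum-suc f = pointwise-≈ λ _ → refl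

+-cong : ∀ {x y u v} → x ≈ y → u ≈ v → x + u ≈ y + v
+-cong x≈y u≈v = ≤-antisym
  (+-mono-≤ (≤-reflexive x≈y) (≤-reflexive u≈v))
  (+-mono-≤ (≤-reflexive (≈-sym x≈y)) (≤-reflexive (≈-sym u≈v)))

x≤x+y : ∀ {x y} → 0ℝ ≤ y → x ≤ x + y
x≤x+y {x} {y} 0≤y = begin
  x        ≈⟨ +-identityʳ x ⟨
  x + 0ℝ   ≤⟨ +-mono-≤ ≤-refl 0≤y ⟩
  x + y    ∎
  where open ≤-Reasoning

x+y≈0⇒x≈0 : ∀ {x y} → 0ℝ ≤ x → 0ℝ ≤ y → x + y ≈ 0ℝ → x ≈ 0ℝ
x+y≈0⇒x≈0 0≤x 0≤y x+y≈0 = ≤-antisym (≤-trans (x≤x+y 0≤y) (≤-reflexive x+y≈0)) 0≤x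

x⊓y≤x : ∀ x y → x ⊓ℝ y ≤ x
x⊓y≤x x y = pointwise-≤ λ n → ℚ.p⊓q≤p (seq x n) (seq y n)

x⊓y≤y : ∀ x y → x ⊓ℝ y ≤ y
x⊓y≤y x y = pointwise-≤ λ n → ℚ.p⊓q≤q (seq x n) (seq y n)

-- Infima over all subsets.

⨅-lower : ∀ {m} (f : Subset m → ℝ) T → ⨅ f ≤ f T
⨅-lower f []            = ≤-refl
⨅-lower f (outside ∷ T) = ≤-trans (x⊓y≤x (⨅ (f ∘ (outside ∷_))) (⨅ (f ∘ (inside ∷_)))) (⨅-lower (f ∘ (outside ∷_)) T)
⨅-lower f (inside ∷ T)  = ≤-trans (x⊓y≤y (⨅ (f ∘ (outside ∷_))) (⨅ (f ∘ (inside ∷_)))) (⨅-lower (f ∘ (inside ∷_)) T)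

-- The offset makes it possible to treat a sum of two infima one infimum at a time, as in the
-- subadditivity of minimum cuts.
⨅-+-glb : ∀ {m x u} (f : Subset m → ℝ) → (∀ T → x ≤ f T + u) → x ≤ ⨅ f + u
⨅-+-glb {zero}  f x≤ = x≤ []
⨅-+-glb {suc m} f x≤ =
  ⊓-+-glb {y = ⨅ (f ∘ (outside ∷_))} {z = ⨅ (f ∘ (inside ∷_))}
    (⨅-+-glb (f ∘ (outside ∷_)) (x≤ ∘ (outside ∷_)))
    (⨅-+-glb (f ∘ (inside ∷_)) (x≤ ∘ (inside ∷_)))

⨅-glb : ∀ {m x} (f : Subset m → ℝ) → (∀ T → x ≤ f T) → x ≤ ⨅ f
⨅-glb {x = x} f x≤ = begin
  x          ≤⟨ ⨅-+-glb f (λ T → ≤-trans (x≤ T) (x≤x+y ≤-refl)) ⟩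
  ⨅ f + 0ℝ   ≈⟨ +-identityʳ (⨅ f) ⟩
  ⨅ f        ∎
  where open ≤-Reasoning

⨅-mono : ∀ {m} (f g : Subset m → ℝ) → (∀ T → f T ≤ g T) → ⨅ f ≤ ⨅ g
⨅-mono f g f≤g = ⨅-glb g λ T → ≤-trans (⨅-lower f T) (f≤g T)

⨅-cong : ∀ {m} (f g : Subset m → ℝ) → (∀ T → f T ≈ g T) → ⨅ f ≈ ⨅ g
⨅-cong f g f≈g = ≤-antisym (⨅-mono f g λ T → ≤-reflexive (f≈g T))
                           (⨅-mono g f λ T → ≤-reflexive (≈-sym (f≈g T)))

-- Order and additivity of finite sums.

sum-mono : ∀ {n} (f g : Fin n → ℝ) → (∀ i → f i ≤ g i) → sum f ≤ sum g
sum-mono {zero}  f g f≤g = ≤-refl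
sum-mono {suc n} f g f≤g = begin
  sum f                     ≈⟨ sum-suc f ⟩
  f zero + sum (f ∘ suc)    ≤⟨ +-mono-≤ (f≤g zero) (sum-mono (f ∘ suc) (g ∘ suc) (f≤g ∘ suc)) ⟩
  g zero + sum (g ∘ suc)    ≈⟨ sum-suc g ⟨
  sum g                     ∎
  where open ≤-Reasoning

sum-nonneg : ∀ {n} (f : Fin n → ℝ) → (∀ i → 0ℝ ≤ f i) → 0ℝ ≤ sum f
sum-nonneg {n} f 0≤f = begin
  0ℝ                        ≈⟨ sum-replicate-zero n ⟨
  sum {n} (λ _ → 0ℝ)        ≤⟨ sum-mono (λ _ → 0ℝ) f 0≤f ⟩
  sum f                     ∎
  where open ≤-Reasoning

∑∑-cong : ∀ {m n} {f g : Fin m → Fin n → ℝ} → (∀ i j → f i j ≈ g i j) →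
          sum (λ i → sum (f i)) ≈ sum (λ i → sum (g i))
∑∑-cong f≈g = sum-cong-≋ λ i → sum-cong-≋ (f≈g i)

sum-+ : ∀ {n} (f g : Fin n → ℝ) → sum (λ i → f i + g i) ≈ sum f + sum g
sum-+ {zero}  f g = ≈-sym (+-identityˡ 0ℝ)
sum-+ {suc n} f g = begin
  sum (λ i → f i + g i)
    ≈⟨ sum-suc (λ i → f i + g i) ⟩
  (f zero + g zero) + sum (λ i → f (suc i) + g (suc i))
    ≈⟨ +-cong ≈-refl (sum-+ (f ∘ suc) (g ∘ suc)) ⟩
  (f zero + g zero) + (sum (f ∘ suc) + sum (g ∘ suc))
    ≈⟨ +-interchange (f zero) (g zero) (sum (f ∘ suc)) (sum (g ∘ suc)) ⟩
  (f zero + sum (f ∘ suc)) + (g zero + sum (g ∘ suc))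
    ≈⟨ +-cong (sum-suc f) (sum-suc g) ⟨
  sum f + sum g ∎
  where open ≈-Reasoning

∑∑-+ : ∀ {m n} (f g : Fin m → Fin n → ℝ) →
       sum (λ i → sum (λ j → f i j + g i j)) ≈ sum (λ i → sum (f i)) + sum (λ i → sum (g i))
∑∑-+ f g = begin
  sum (λ i → sum (λ j → f i j + g i j))          ≈⟨ sum-cong-≋ (λ i → sum-+ (f i) (g i)) ⟩
  sum (λ i → sum (f i) + sum (g i))              ≈⟨ sum-+ (λ i → sum (f i)) (λ i → sum (g i)) ⟩
  sum (λ i → sum (f i)) + sum (λ i → sum (g i))  ∎
  where open ≈-Reasoning

-- Indicators and summation over fibres.

infix 9 [_]_

[_]_ : Bool → ℝ → ℝ
[ b ] x = if b then x else 0ℝ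

[]-nonneg : ∀ b {x} → 0ℝ ≤ x → 0ℝ ≤ [ b ] x
[]-nonneg true  0≤x = 0≤x
[]-nonneg false 0≤x = ≤-refl

[]-zero : ∀ b → [ b ] 0ℝ ≡ 0ℝ
[]-zero true  = refl
[]-zero false = refl

[]-+ : ∀ b x y → [ b ] (x + y) ≈ [ b ] x + [ b ] y
[]-+ true  x y = ≈-refl
[]-+ false x y = ≈-sym (+-identityˡ 0ℝ)

[]-swap : ∀ b c x → [ b ] ([ c ] x) ≡ [ c ] ([ b ] x)
[]-swap true  c x = refl
[]-swap false c x = sym ([]-zero c)

[]-sum : ∀ b {n} (f : Fin n → ℝ) → [ b ] sum f ≈ sum (λ i → [ b ] f i)
[]-sum true      f = ≈-refl
[]-sum false {n} f = ≈-sym (sum-replicate-zero n)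

sum-δ : ∀ {n} p (f : Fin n → ℝ) → sum (λ q → [ does (p Fin.≟ q) ] f q) ≈ f p
sum-δ {suc n} zero f = begin
  sum (λ q → [ does (zero Fin.≟ q) ] f q)  ≈⟨ sum-suc (λ q → [ does (zero Fin.≟ q) ] f q) ⟩
  f zero + sum {n} (λ _ → 0ℝ)              ≈⟨ +-cong ≈-refl (sum-replicate-zero n) ⟩
  f zero + 0ℝ                              ≈⟨ +-identityʳ (f zero) ⟩
  f zero                                   ∎
  where open ≈-Reasoning
sum-δ {suc n} (suc p) f = begin
  sum (λ q → [ does (suc p Fin.≟ q) ] f q)         ≈⟨ sum-suc (λ q → [ does (suc p Fin.≟ q) ] f q) ⟩
  0ℝ + sum (λ q → [ does (p Fin.≟ q) ] f (suc q))  ≈⟨ +-identityˡ (sum λ q → [ does (p Fin.≟ q) ] f (suc q)) ⟩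
  sum (λ q → [ does (p Fin.≟ q) ] f (suc q))       ≈⟨ sum-δ p (f ∘ suc) ⟩
  f (suc p)                                        ∎
  where open ≈-Reasoning

-- After the sums are exchanged, each `j` lies in exactly one fibre of `g`, the one over `g j`, and
-- the Kronecker sum picks out that term.
sum-fiber : ∀ {m n} (g : Fin m → Fin n) (c : Fin n → Bool) (y : Fin m → ℝ) →
  sum (λ q → [ c q ] sum (λ j → [ does (g j Fin.≟ q) ] y j)) ≈ sum (λ j → [ c (g j) ] y j)
sum-fiber g c y = begin
  sum (λ q → [ c q ] sum (λ j → δ j q (y j)))  ≈⟨ sum-cong-≋ (λ q → []-sum (c q) (λ j → δ j q (y j))) ⟩
  sum (λ q → sum (λ j → [ c q ] δ j q (y j)))  ≈⟨ ∑-comm (λ q j → [ c q ] δ j q (y j)) ⟩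
  sum (λ j → sum (λ q → [ c q ] δ j q (y j)))  ≈⟨ ∑∑-cong (λ j q → ≡⇒≈ ([]-swap (c q) (does (g j Fin.≟ q)) (y j))) ⟩
  sum (λ j → sum (λ q → δ j q ([ c q ] y j)))  ≈⟨ sum-cong-≋ (λ j → sum-δ (g j) (λ q → [ c q ] y j)) ⟩
  sum (λ j → [ c (g j) ] y j)                  ∎
  where
  open ≈-Reasoning
  δ : _ → _ → ℝ → ℝ
  δ j q x = [ does (g j Fin.≟ q) ] x

-- Sums over edges and cuts

-- P abstracts over the summand, so that one case distinction on i < j serves
-- any number of summands and no real number gets normalised by `with`.
extendBy0-elim : ∀ {N} (i j : Fin N) (P : ((Edge N → ℝ) → ℝ) → Set) →
  (∀ (i<j : i Fin.< j) → P (λ f → f (edge i j i<j))) → (¬ i Fin.< j → P (λ _ → 0ℝ)) →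
  P (λ f → extendBy0 f i j)
extendBy0-elim i j P p q with i Fin.<? j
... | yes i<j = p i<j
... | no  i≮j = q i≮j

extendBy0-nonneg : ∀ {N} (f : Edge N → ℝ) → (∀ e → 0ℝ ≤ f e) → ∀ i j → 0ℝ ≤ extendBy0 f i j
extendBy0-nonneg f 0≤f i j = extendBy0-elim i j (λ ext → 0ℝ ≤ ext f)
  (λ i<j → 0≤f (edge i j i<j)) (λ _ → ≤-refl)

∑edges-nonneg : ∀ {N} (f : Edge N → ℝ) → (∀ e → 0ℝ ≤ f e) → 0ℝ ≤ ∑edges f
∑edges-nonneg f 0≤f = sum-nonneg _ λ i → sum-nonneg _ (extendBy0-nonneg f 0≤f i)

∑edges-mono : ∀ {N} (f g : Edge N → ℝ) → (∀ e → f e ≤ g e) → ∑edges f ≤ ∑edges g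
∑edges-mono f g f≤g = sum-mono _ _ λ i → sum-mono _ _ λ j →
  extendBy0-elim i j (λ ext → ext f ≤ ext g) (λ i<j → f≤g (edge i j i<j)) (λ _ → ≤-refl)

∑edges-cong : ∀ {N} (f g : Edge N → ℝ) → (∀ e → f e ≈ g e) → ∑edges f ≈ ∑edges g
∑edges-cong f g f≈g = ≤-antisym (∑edges-mono f g λ e → ≤-reflexive (f≈g e))
                                (∑edges-mono g f λ e → ≤-reflexive (≈-sym (f≈g e)))

∑edges-+ : ∀ {N} (f g : Edge N → ℝ) → ∑edges (λ e → f e + g e) ≈ ∑edges f + ∑edges g
∑edges-+ f g = begin
  ∑edges (λ e → f e + g e)
    ≈⟨ ∑∑-cong (λ i j → extendBy0-elim i j (λ ext → ext (λ e → f e + g e) ≈ ext f + ext g)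
         (λ _ → ≈-refl) (λ _ → ≈-sym (+-identityˡ 0ℝ))) ⟩
  sum (λ i → sum (λ j → extendBy0 f i j + extendBy0 g i j))
    ≈⟨ ∑∑-+ (extendBy0 f) (extendBy0 g) ⟩
  ∑edges f + ∑edges g ∎
  where open ≈-Reasoning

onEdges : ∀ {N} → (Fin N → Fin N → ℝ) → Edge N → ℝ
onEdges b (edge i j _) = b i j

-- Off the diagonal exactly one of the two orders holds, and its term is `b i j`. If neither holds,
-- then `i` and `j` coincide, and both sides vanish by the hypothesis on the diagonal.
extendBy0-split : ∀ {N} (b : Fin N → Fin N → ℝ) → (∀ i → b i i ≈ 0ℝ) → ∀ i j →
  extendBy0 (onEdges b) i j + extendBy0 (onEdges (flip b)) j i ≈ b i j
extendBy0-split b diag i j =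
  extendBy0-elim i j (λ ext → ext (onEdges b) + extendBy0 (onEdges (flip b)) j i ≈ b i j)
    (λ i<j → extendBy0-elim j i (λ ext → b i j + ext (onEdges (flip b)) ≈ b i j)
      (λ j<i → contradiction j<i (ℕ.<-asym i<j))
      (λ _ → +-identityʳ (b i j)))
    (λ i≮j → extendBy0-elim j i (λ ext → 0ℝ + ext (onEdges (flip b)) ≈ b i j)
      (λ _ → +-identityˡ (b i j))
      (λ j≮i → ≈-trans (+-identityˡ 0ℝ)
        (b≈0 (Fin.toℕ-injective (ℕ.≤-antisym (ℕ.≮⇒≥ j≮i) (ℕ.≮⇒≥ i≮j))))))
  where
  b≈0 : ∀ {i j} → i ≡ j → 0ℝ ≈ b i j
  b≈0 {i} refl = ≈-sym (diag i)

-- Transposing the second double sum moves its terms to the decreasing pairs, so the two sums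
-- together fill the whole square apart from its zero diagonal.
∑edges-symmetrize : ∀ {N} (b : Fin N → Fin N → ℝ) → (∀ i → b i i ≈ 0ℝ) →
  ∑edges (λ e → onEdges b e + onEdges (flip b) e) ≈ sum (λ i → sum (b i))
∑edges-symmetrize b diag = begin
  ∑edges (λ e → onEdges b e + onEdges (flip b) e)
    ≈⟨ ∑edges-+ (onEdges b) (onEdges (flip b)) ⟩
  ∑edges (onEdges b) + ∑edges (onEdges (flip b))
    ≈⟨ +-cong ≈-refl (∑-comm (extendBy0 (onEdges (flip b)))) ⟩
  ∑edges (onEdges b) + sum (λ i → sum (λ j → extendBy0 (onEdges (flip b)) j i))
    ≈⟨ ∑∑-+ (extendBy0 (onEdges b)) (λ i j → extendBy0 (onEdges (flip b)) j i) ⟨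
  sum (λ i → sum (λ j → extendBy0 (onEdges b) i j + extendBy0 (onEdges (flip b)) j i))
    ≈⟨ ∑∑-cong (extendBy0-split b diag) ⟩
  sum (λ i → sum (b i)) ∎
  where open ≈-Reasoning

-- In a weighted directed graph, counting both directions.
cut : ∀ {N} → (Fin N → Fin N → ℝ) → (Fin N → Bool) → ℝ
cut a V = sum λ i → sum λ j → [ V i xor V j ] a i j

cut-cong : ∀ {N} (a : Fin N → Fin N → ℝ) {V W : Fin N → Bool} → (∀ i → V i ≡ W i) → cut a V ≈ cut a W
cut-cong a V≡W = ∑∑-cong λ i j → ≡⇒≈ (cong₂ (λ b c → [ b xor c ] a i j) (V≡W i) (V≡W j))

-- The matrix `extendBy0 (weight w)` is supported on increasing pairs, so counting both directions
-- still counts each edge once.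
‖C‖≈cut : ∀ {N} (w : WeightMap N) W → ‖C‖ w W ≈ cut (extendBy0 (weight w)) (lookup W)
‖C‖≈cut w W = ∑∑-cong λ i j → extendBy0-elim i j
  (λ ext → ext (λ e → [ e ∈C W ] weight w e) ≈ [ lookup W i xor lookup W j ] ext (weight w))
  (λ _ → ≈-refl) (λ _ → ≡⇒≈ (sym ([]-zero (lookup W i xor lookup W j))))

-- An undirected edge collects the weights of both of its directions; the diagonal entries, which
-- are loops, are dropped.
symmetrize : ∀ {N} (a : Fin N → Fin N → ℝ) → (∀ i j → 0ℝ ≤ a i j) → WeightMap N
symmetrize a 0≤a = record
  { weight   = λ e → onEdges a e + onEdges (flip a) e
  ; weight≥0 = λ (edge i j _) → to≤ℝ (≤-trans (0≤a i j) (x≤x+y (0≤a j i)))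
  }

-- Both ends of a loop lie on the same side of any set, so dropping the diagonal changes no cut.
‖C‖-symmetrize : ∀ {N} (a : Fin N → Fin N → ℝ) (0≤a : ∀ i j → 0ℝ ≤ a i j) W →
                 ‖C‖ (symmetrize a 0≤a) W ≈ cut a (lookup W)
‖C‖-symmetrize a 0≤a W = begin
  ‖C‖ (symmetrize a 0≤a) W
    ≈⟨ ∑edges-cong _ (λ e → onEdges b e + onEdges (flip b) e) pointwise ⟩
  ∑edges (λ e → onEdges b e + onEdges (flip b) e)
    ≈⟨ ∑edges-symmetrize b (λ i → ≡⇒≈ (cong ([_] a i i) (xor-same (lookup W i)))) ⟩
  cut a (lookup W) ∎
  where
  open ≈-Reasoning
  b : _ → _ → ℝ
  b i j = [ lookup W i xor lookup W j ] a i j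
  pointwise : ∀ e → [ e ∈C W ] weight (symmetrize a 0≤a) e ≈ onEdges b e + onEdges (flip b) e
  pointwise (edge i j _) = ≈-trans ([]-+ (lookup W i xor lookup W j) (a i j) (a j i))
    (+-cong ≈-refl (≡⇒≈ (cong ([_] a j i) (xor-comm (lookup W i) (lookup W j)))))

-- Pushing weights forward along a map of vertices.

push : ∀ {M N} → (Fin M → Fin N) → (Fin M → Fin M → ℝ) → Fin N → Fin N → ℝ
push g a p q = sum λ i → [ does (g i Fin.≟ p) ] sum λ j → [ does (g j Fin.≟ q) ] a i j

push-nonneg : ∀ {M N} (g : Fin M → Fin N) a → (∀ i j → 0ℝ ≤ a i j) → ∀ p q → 0ℝ ≤ push g a p q
push-nonneg g a 0≤a p q =
  sum-nonneg _ λ i → []-nonneg (does (g i Fin.≟ p)) (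
  sum-nonneg _ λ j → []-nonneg (does (g j Fin.≟ q)) (0≤a i j))

-- Fibre summation is applied twice, first to the tails of the arcs and then to their heads.
cut-push : ∀ {M N} (g : Fin M → Fin N) a W → cut (push g a) W ≈ cut a (W ∘ g)
cut-push g a W = begin
  sum (λ p → sum (λ q → [ W p xor W q ] push g a p q))
    ≈⟨ ∑-comm (λ p q → [ W p xor W q ] push g a p q) ⟩
  sum (λ q → sum (λ p → [ W p xor W q ] push g a p q))
    ≈⟨ sum-cong-≋ (λ q → sum-fiber g (λ p → W p xor W q) (λ i → row i q)) ⟩
  sum (λ q → sum (λ i → [ W (g i) xor W q ] row i q))
    ≈⟨ ∑-comm (λ q i → [ W (g i) xor W q ] row i q) ⟩
  sum (λ i → sum (λ q → [ W (g i) xor W q ] row i q))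
    ≈⟨ sum-cong-≋ (λ i → sum-fiber g (λ q → W (g i) xor W q) (a i)) ⟩
  cut a (W ∘ g) ∎
  where
  open ≈-Reasoning
  row : _ → _ → ℝ
  row i q = sum λ j → [ does (g j Fin.≟ q) ] a i j

pushforward : ∀ {M N} → (Fin M → Fin N) → WeightMap M → WeightMap N
pushforward g w = symmetrize (push g (extendBy0 (weight w)))
  (push-nonneg g (extendBy0 (weight w)) (extendBy0-nonneg (weight w) λ e → ⟨ weight≥0 w e ⟩))

-- The preimage of `W` is given as a separate subset `V` with a pointwise equation, so that it can
-- be a concatenation of the shape found in `minCut`.
‖C‖-pushforward : ∀ {M N} (g : Fin M → Fin N) (w : WeightMap M) V W →
  (∀ i → lookup W (g i) ≡ lookup V i) → ‖C‖ (pushforward g w) W ≈ ‖C‖ w V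
‖C‖-pushforward g w V W W∘g≡V = begin
  ‖C‖ (pushforward g w) W        ≈⟨ ‖C‖-symmetrize (push g a) (push-nonneg g a 0≤a) W ⟩
  cut (push g a) (lookup W)      ≈⟨ cut-push g a (lookup W) ⟩
  cut a (lookup W ∘ g)           ≈⟨ cut-cong a W∘g≡V ⟩
  cut a (lookup V)               ≈⟨ ‖C‖≈cut w V ⟨
  ‖C‖ w V                        ∎
  where
  open ≈-Reasoning
  a = extendBy0 (weight w)
  0≤a = extendBy0-nonneg (weight w) λ e → ⟨ weight≥0 w e ⟩

-- Nonnegativity and subadditivity of cuts.

‖C‖-nonneg : ∀ {N} (w : WeightMap N) W → 0ℝ ≤ ‖C‖ w W
‖C‖-nonneg w W = ∑edges-nonneg _ λ e → []-nonneg (e ∈C W) ⟨ weight≥0 w e ⟩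

‖C‖-⊥ : ∀ {N} (w : WeightMap N) → ‖C‖ w ⊥ ≈ 0ℝ
‖C‖-⊥ {N} w = begin
  ‖C‖ w ⊥                             ≈⟨ ‖C‖≈cut w ⊥ ⟩
  cut a (lookup ⊥)                    ≈⟨ cut-cong a (λ i → lookup-replicate i outside) ⟩
  sum {N} (λ _ → sum {N} λ _ → 0ℝ)    ≈⟨ sum-cong-≋ (λ (_ : Fin N) → sum-replicate-zero N) ⟩
  sum {N} (λ _ → 0ℝ)                  ≈⟨ sum-replicate-zero N ⟩
  0ℝ                                  ∎
  where
  open ≈-Reasoning
  a = extendBy0 (weight w)

infixl 6 _△_

_△_ : ∀ {n} → Subset n → Subset n → Subset n
_△_ = zipWith _xor_

-- Regrouping turns the indicator on the left into the exclusive or of the two indicators on the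
-- right, and an exclusive or is at most the sum.
[]-xor-≤ : ∀ a b c d {x} → 0ℝ ≤ x →
           [ (a xor b) xor (c xor d) ] x ≤ [ a xor c ] x + [ b xor d ] x
[]-xor-≤ a b c d {x} 0≤x = subst (λ e → [ e ] x ≤ [ a xor c ] x + [ b xor d ] x)
  (interchange a c b d) (split (a xor c) (b xor d))
  where
  open import Algebra.Properties.CommutativeSemigroup
    (CommutativeRing.+-commutativeSemigroup xor-∧-commutativeRing) using (interchange)
  split : ∀ e f → [ e xor f ] x ≤ [ e ] x + [ f ] x
  split true  true  = ≤-trans 0≤x (x≤x+y 0≤x)
  split true  false = x≤x+y ≤-refl
  split false f     = ≤-reflexive (≈-sym (+-identityˡ ([ f ] x)))

-- An edge that crosses `V △ W` crosses exactly one of `V` and `W`, so the bound holds edge by edge.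
‖C‖-△ : ∀ {N} (w : WeightMap N) V W → ‖C‖ w (V △ W) ≤ ‖C‖ w V + ‖C‖ w W
‖C‖-△ w V W = begin
  ‖C‖ w (V △ W)
    ≤⟨ ∑edges-mono _ (λ e → [ e ∈C V ] weight w e + [ e ∈C W ] weight w e) pointwise ⟩
  ∑edges (λ e → [ e ∈C V ] weight w e + [ e ∈C W ] weight w e)
    ≈⟨ ∑edges-+ (λ e → [ e ∈C V ] weight w e) (λ e → [ e ∈C W ] weight w e) ⟩
  ‖C‖ w V + ‖C‖ w W ∎
  where
  open ≤-Reasoning
  pointwise : ∀ e → [ e ∈C (V △ W) ] weight w e ≤ [ e ∈C V ] weight w e + [ e ∈C W ] weight w e
  pointwise e@(edge i j _) = subst₂
    (λ a b → [ a xor b ] weight w e ≤ [ e ∈C V ] weight w e + [ e ∈C W ] weight w e)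
    (sym (lookup-zipWith _xor_ i V W)) (sym (lookup-zipWith _xor_ j V W))
    ([]-xor-≤ (lookup V i) (lookup W i) (lookup V j) (lookup W j) ⟨ weight≥0 w e ⟩)

-- Minimum cuts

△-∷ʳ : ∀ {n} (I J : Subset n) b c → (I ∷ʳ b) △ (J ∷ʳ c) ≡ (I △ J) ∷ʳ (b xor c)
△-∷ʳ []      []      b c = refl
△-∷ʳ (x ∷ I) (y ∷ J) b c = cong ((x xor y) ∷_) (△-∷ʳ I J b c)

⊥-∷ʳ : ∀ n → ⊥ {n} ∷ʳ outside ≡ ⊥
⊥-∷ʳ zero    = refl
⊥-∷ʳ (suc n) = cong (outside ∷_) (⊥-∷ʳ n)

⊥-++ : ∀ n m → ⊥ {n} ++ ⊥ {m} ≡ ⊥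
⊥-++ zero    m = refl
⊥-++ (suc n) m = cong (outside ∷_) (⊥-++ n m)

-- Unlike a `Vector`, `μ` also has a value at `⊥`, which serves the subsets of [n+1] whose
-- intersection with [n] is empty.
record IsCutFunction {n} (μ : Subset n → ℝ) : Set where
  field
    nonneg      : ∀ I → 0ℝ ≤ μ I
    ⊥≈0         : μ ⊥ ≈ 0ℝ
    subadditive : ∀ I J → μ (I △ J) ≤ μ I + μ J

-- Toggling n+1 is the symmetric difference with {n+1}, which has value zero, so by subadditivity it
-- cannot increase `μ`; toggling again undoes it.
toggle-last : ∀ {n} {μ : Subset (suc n) → ℝ} → IsCutFunction μ → μ (⊥ ∷ʳ inside) ≈ 0ℝ →
              ∀ I b → μ (I ∷ʳ b) ≈ μ (I ∷ʳ outside)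
toggle-last {μ = μ} μ-cut μ≈0 I outside = ≈-refl
-- The two instances of `toggle` are opposite inequalities, because `inside xor inside` computes to
-- `outside`.
toggle-last {μ = μ} μ-cut μ≈0 I inside  = ≤-antisym (toggle outside) (toggle inside)
  where
  open ≤-Reasoning
  toggle : ∀ b → μ (I ∷ʳ (b xor inside)) ≤ μ (I ∷ʳ b)
  toggle b = begin
    μ (I ∷ʳ (b xor inside))          ≡⟨ cong (λ J → μ (J ∷ʳ (b xor inside))) (zipWith-identityʳ xor-identityʳ I) ⟨
    μ ((I △ ⊥) ∷ʳ (b xor inside))    ≡⟨ cong μ (△-∷ʳ I ⊥ b inside) ⟨
    μ ((I ∷ʳ b) △ (⊥ ∷ʳ inside))     ≤⟨ IsCutFunction.subadditive μ-cut (I ∷ʳ b) (⊥ ∷ʳ inside) ⟩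
    μ (I ∷ʳ b) + μ (⊥ ∷ʳ inside)     ≈⟨ +-cong ≈-refl μ≈0 ⟩
    μ (I ∷ʳ b) + 0ℝ                  ≈⟨ +-identityʳ (μ (I ∷ʳ b)) ⟩
    μ (I ∷ʳ b)                       ∎

module _ {n m} (w : WeightMap (n ℕ.+ suc m)) where

  private
    c : Subset n → Subset m → ℝ
    c I T = ‖C‖ w (I ++ (T ∷ʳ outside))

    μ : Subset n → ℝ
    μ = minCut {n} {m} w

  minCut-nonneg : ∀ I → 0ℝ ≤ μ I
  minCut-nonneg I = ⨅-glb (c I) λ T → ‖C‖-nonneg w (I ++ (T ∷ʳ outside))

  -- The empty set is admissible for `⊥` and cuts no edge.
  minCut-⊥ : μ ⊥ ≈ 0ℝ
  minCut-⊥ = ≤-antisym (begin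
    μ ⊥                           ≤⟨ ⨅-lower (c ⊥) ⊥ ⟩
    ‖C‖ w (⊥ ++ (⊥ ∷ʳ outside))   ≡⟨ cong (‖C‖ w) (trans (cong (⊥ {n} ++_) (⊥-∷ʳ m)) (⊥-++ n (suc m))) ⟩
    ‖C‖ w ⊥                       ≈⟨ ‖C‖-⊥ w ⟩
    0ℝ                            ∎)
    (minCut-nonneg ⊥)
    where open ≤-Reasoning

  -- If two sets are admissible for `I` and `J`, their symmetric difference is admissible for
  -- `I △ J`: the sink stays outside because `outside xor outside` is `outside`.
  minCut-△ : ∀ I J → μ (I △ J) ≤ μ I + μ J
  minCut-△ I J = ⨅-+-glb (c I) λ T → begin
    -- The infima over `T` and `U` are bounded one after the other, each with the other summand as
    -- its offset; the commutations bring the active one to the front.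
    μ (I △ J)      ≤⟨ ⨅-+-glb (c J) (bound T) ⟩
    μ J + c I T   ≈⟨ +-comm (μ J) (c I T) ⟩
    c I T + μ J   ∎
    where
    open ≤-Reasoning
    bound : ∀ T U → μ (I △ J) ≤ c J U + c I T
    bound T U = begin
      μ (I △ J)
        ≤⟨ ⨅-lower (c (I △ J)) (T △ U) ⟩
      c (I △ J) (T △ U)
        ≡⟨ cong (λ V → ‖C‖ w ((I △ J) ++ V)) (△-∷ʳ T U outside outside) ⟨
      ‖C‖ w ((I △ J) ++ ((T ∷ʳ outside) △ (U ∷ʳ outside)))
        ≡⟨ cong (‖C‖ w) (zipWith-++ _xor_ I (T ∷ʳ outside) J (U ∷ʳ outside)) ⟨
      ‖C‖ w ((I ++ (T ∷ʳ outside)) △ (J ++ (U ∷ʳ outside)))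
        ≤⟨ ‖C‖-△ w (I ++ (T ∷ʳ outside)) (J ++ (U ∷ʳ outside)) ⟩
      c I T + c J U
        ≈⟨ +-comm (c I T) (c J U) ⟩
      c J U + c I T ∎

  minCut-isCutFunction : IsCutFunction μ
  minCut-isCutFunction = record
    { nonneg = minCut-nonneg ; ⊥≈0 = minCut-⊥ ; subadditive = minCut-△ }

-- Isolating and contracting the terminal n+1.

isolate : ∀ n {m} → Fin (n ℕ.+ suc m) → Fin (suc n ℕ.+ suc m)
isolate zero    j       = suc j
isolate (suc n) zero    = zero
isolate (suc n) (suc j) = suc (isolate n j)

lookup-isolate : ∀ {n m} (I : Subset n) b (V : Subset (suc m)) j →
                 lookup ((I ∷ʳ b) ++ V) (isolate n j) ≡ lookup (I ++ V) j
lookup-isolate []      b V j       = refl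
lookup-isolate (x ∷ I) b V zero    = refl
lookup-isolate (x ∷ I) b V (suc j) = lookup-isolate I b V j

-- Maps the vertex n+1 to the sink.
contract : ∀ n {m} → Fin (suc n ℕ.+ suc m) → Fin (n ℕ.+ suc m)
contract zero    {m} zero    = Fin.fromℕ m
contract zero        (suc j) = j
contract (suc n)     zero    = zero
contract (suc n)     (suc j) = suc (contract n j)

lookup-∷ʳ-fromℕ : ∀ {m} (T : Subset m) b → lookup (T ∷ʳ b) (Fin.fromℕ m) ≡ b
lookup-∷ʳ-fromℕ []      b = refl
lookup-∷ʳ-fromℕ (_ ∷ T) b = lookup-∷ʳ-fromℕ T b

-- The terminal n+1 is sent to the sink, so the same entry `b` has to stand at both places.
lookup-contract : ∀ {n m} (I : Subset n) (T : Subset m) b j →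
  lookup (I ++ (T ∷ʳ b)) (contract n j) ≡ lookup ((I ∷ʳ b) ++ (T ∷ʳ b)) j
lookup-contract []      T b zero    = lookup-∷ʳ-fromℕ T b
lookup-contract []      T b (suc j) = refl
lookup-contract (x ∷ I) T b zero    = refl
lookup-contract (x ∷ I) T b (suc j) = lookup-contract I T b j

-- The image of `isolate` misses index `n`, so the terminal n+1 meets only edges of weight zero and
-- its side `b` is arbitrary. Both infima range over the same `T`.
minCut-isolate : ∀ {n m} (w : WeightMap (n ℕ.+ suc m)) I b →
  minCut {suc n} {m} (pushforward (isolate n) w) (I ∷ʳ b) ≈ minCut {n} {m} w I
minCut-isolate {n} w I b = ⨅-cong _ _ λ T →
  ‖C‖-pushforward (isolate n) w (I ++ (T ∷ʳ outside)) ((I ∷ʳ b) ++ (T ∷ʳ outside))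
    (lookup-isolate I b (T ∷ʳ outside))

-- The sink is always `outside`, so a terminal merged with it counts as `outside` too; this is
-- exactly the choice that `project` makes.
minCut-contract : ∀ {n m} (w : WeightMap (suc n ℕ.+ suc m)) I →
  minCut {n} {m} (pushforward (contract n) w) I ≈ minCut {suc n} {m} w (I ∷ʳ outside)
minCut-contract {n} w I = ⨅-cong _ _ λ T →
  ‖C‖-pushforward (contract n) w ((I ∷ʳ outside) ++ (T ∷ʳ outside)) (I ++ (T ∷ʳ outside))
    (lookup-contract I T outside)

-- Zero-lifts and projections

∷ʳ-init-last : ∀ {n} (J : Subset (suc n)) → J ≡ init J ∷ʳ last J
∷ʳ-init-last J = proj₂ (proj₂ (initLast J))

-- `P` receives the value as a function of the vector, so one case distinction settles statements
-- about the zero-lifts of several vectors.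
zeroLift-elim : ∀ {n} (J : Subset (suc n)) .(p : Nonempty J) (P : (Vector n → ℝ) → Set) →
  (∀ (I≢∅ : Nonempty (init J)) → P (λ S → S (init J) I≢∅)) →
  (¬ Nonempty (init J) → P (λ _ → 0ℝ)) →
  P (λ S → zeroLift S J p)
zeroLift-elim J p P q r with nonempty? (init J)
... | yes I≢∅ = q I≢∅
... | no  I≡∅ = r I≡∅

Vector-cong : ∀ {n} (S : Vector n) {I J} .{p : Nonempty I} .{q : Nonempty J} → I ≡ J → S I p ≈ S J q
Vector-cong S refl = ≈-refl

project-zeroLift : ∀ {n} (S : Vector n) → project (zeroLift S) ≋ S
project-zeroLift {n} S I I≢∅ = to≈ℝ (zeroLift-elim (I ∷ʳ outside) (Nonempty-∷ʳ outside I≢∅)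
  (λ value → value S ≈ S I I≢∅)
  (λ _ → Vector-cong S init-I)
  (λ I≡∅ → contradiction-irr (subst Nonempty (sym init-I) I≢∅) I≡∅))
  where
  init-I = init-∷ʳ outside I

-- The default `0ℝ` of `zeroLift` appears exactly when `init J` is empty, and there `μ ⊥ ≈ 0ℝ`
-- provides the match.
zeroLift-values : ∀ {n} (S : Vector n) (μ : Subset n → ℝ) (μ′ : Subset (suc n) → ℝ) →
  (∀ I .(I≢∅ : Nonempty I) → S I I≢∅ ≈ μ I) → μ ⊥ ≈ 0ℝ → (∀ I b → μ′ (I ∷ʳ b) ≈ μ I) →
  ∀ J .(J≢∅ : Nonempty J) → zeroLift S J J≢∅ ≈ μ′ J
zeroLift-values S μ μ′ S≈μ μ⊥≈0 μ′≈μ J J≢∅ = begin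
  zeroLift S J J≢∅        ≈⟨ zeroLift-elim J J≢∅ (λ value → value S ≈ μ (init J))
                               (λ I≢∅ → S≈μ (init J) I≢∅)
                               (λ I≡∅ → ≈-sym (≈-trans (≡⇒≈ (cong μ (Empty-unique I≡∅))) μ⊥≈0)) ⟩
  μ (init J)              ≈⟨ μ′≈μ (init J) (last J) ⟨
  μ′ (init J ∷ʳ last J)   ≡⟨ cong μ′ (∷ʳ-init-last J) ⟨
  μ′ J                    ∎
  where open ≈-Reasoning

-- Passing membership between consecutive cones.

H-zeroLift : ∀ {n} (S : Vector n) → H n S → H (suc n) (zeroLift S)
-- The number `m` of auxiliary vertices is kept: the added vertex is a terminal.
H-zeroLift {n} S (m , w , realizes) = m , pushforward (isolate n) w , λ J J≢∅ →
  to≈ℝ (zeroLift-values S (minCut {n} {m} w) (minCut {suc n} {m} (pushforward (isolate n) w))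
    (λ I I≢∅ → ⟨ realizes I I≢∅ ⟩) (minCut-⊥ {n} {m} w) (minCut-isolate {n} {m} w) J J≢∅)

H-project : ∀ {n} (S : Vector (suc n)) → H (suc n) S → H n (project S)
H-project {n} S (m , w , realizes) = m , pushforward (contract n) w , λ I I≢∅ →
  to≈ℝ (begin
    project S I I≢∅                                 ≈⟨ ⟨ realizes (I ∷ʳ outside) (Nonempty-∷ʳ outside I≢∅) ⟩ ⟩
    minCut {suc n} {m} w (I ∷ʳ outside)             ≈⟨ minCut-contract {n} {m} w I ⟨
    minCut {n} {m} (pushforward (contract n) w) I   ∎)
  where open ≈-Reasoning

H-cong : ∀ {n} (S T : Vector n) → S ≋ T → H n S → H n T
H-cong {n} S T S≋T (m , w , realizes) = m , w , λ I I≢∅ → to≈ℝ (begin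
  T I I≢∅              ≈⟨ ⟨ S≋T I I≢∅ ⟩ ⟨
  S I I≢∅              ≈⟨ ⟨ realizes I I≢∅ ⟩ ⟩
  minCut {n} {m} w I   ∎)
  where open ≈-Reasoning

H-nonneg : ∀ {n} (S : Vector n) → H n S → ∀ I .(I≢∅ : Nonempty I) → 0ℝ ≤ S I I≢∅
H-nonneg {n} S (m , w , realizes) I I≢∅ = begin
  0ℝ                   ≤⟨ minCut-nonneg {n} {m} w I ⟩
  minCut {n} {m} w I   ≈⟨ ⟨ realizes I I≢∅ ⟩ ⟨
  S I I≢∅              ∎
  where open ≤-Reasoning

-- The coordinate of {n+1} and the recognition of zero-lifts.

Nonempty-⊥∷ʳinside : ∀ n → Nonempty (⊥ {n} ∷ʳ inside)
Nonempty-⊥∷ʳinside zero    = zero , here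
Nonempty-⊥∷ʳinside (suc n) with i , i∈ ← Nonempty-⊥∷ʳinside n = suc i , there i∈

lastCoordinate : ∀ {n} → Vector (suc n) → ℝ
lastCoordinate {n} S = S (⊥ ∷ʳ inside) (Nonempty-⊥∷ʳinside n)

zeroLift-lastCoordinate : ∀ {n} (S : Vector n) → lastCoordinate (zeroLift S) ≈ 0ℝ
zeroLift-lastCoordinate {n} S =
  zeroLift-elim (⊥ {n} ∷ʳ inside) (Nonempty-⊥∷ʳinside n) (λ value → value S ≈ 0ℝ)
    (λ I≢∅ → contradiction (proj₂ (subst Nonempty (init-∷ʳ inside ⊥) I≢∅)) ∉⊥)
    (λ _ → ≈-refl)

-- Since n+1 can be toggled freely, `J` may be replaced by `init J ∷ʳ outside`. This is the
-- coordinate read by `project`, or the empty set when `J` is {n+1}.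
zeroLift-project : ∀ {n} (A : Vector (suc n)) {μ : Subset (suc n) → ℝ} → IsCutFunction μ →
  (∀ I .(I≢∅ : Nonempty I) → A I I≢∅ ≈ μ I) → lastCoordinate A ≈ 0ℝ → A ≋ zeroLift (project A)
zeroLift-project {n} A {μ} μ-cut A≈μ A≈0 J J≢∅ = to≈ℝ (begin
  A J J≢∅                      ≈⟨ A≈μ J J≢∅ ⟩
  μ J                          ≡⟨ cong μ (∷ʳ-init-last J) ⟩
  μ (init J ∷ʳ last J)         ≈⟨ toggle-last μ-cut μ≈0 (init J) (last J) ⟩
  μ (init J ∷ʳ outside)        ≈⟨ zeroLift-elim J J≢∅ (λ value → μ (init J ∷ʳ outside) ≈ value (project A))
                                    (λ I≢∅ → ≈-sym (A≈μ (init J ∷ʳ outside) (Nonempty-∷ʳ outside I≢∅)))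
                                    (λ I≡∅ → ≈-trans (≡⇒≈ (cong μ (init∷ʳ≡⊥ I≡∅))) (IsCutFunction.⊥≈0 μ-cut)) ⟩
  zeroLift (project A) J J≢∅   ∎)
  where
  open ≈-Reasoning
  μ≈0 : μ (⊥ ∷ʳ inside) ≈ 0ℝ
  μ≈0 = ≈-trans (≈-sym (A≈μ (⊥ ∷ʳ inside) (Nonempty-⊥∷ʳinside n))) A≈0
  init∷ʳ≡⊥ : ¬ Nonempty (init J) → init J ∷ʳ outside ≡ ⊥
  init∷ʳ≡⊥ I≡∅ = trans (cong (_∷ʳ outside) (Empty-unique I≡∅)) (⊥-∷ʳ n)

H-zeroLift-project : ∀ {n} (A : Vector (suc n)) → H (suc n) A → lastCoordinate A ≈ 0ℝ →
                     A ≋ zeroLift (project A)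
H-zeroLift-project {n} A (m , w , realizes) =
  zeroLift-project A (minCut-isCutFunction {suc n} {m} w) λ I I≢∅ → ⟨ realizes I I≢∅ ⟩

-- The scalar of the projection also works for the lift, since the coordinate filled with zero is
-- unchanged by scaling.
zeroLift-∈ray : ∀ {n} (S : Vector n) (A : Vector (suc n)) → A ≋ zeroLift (project A) →
                project A ∈ray S → A ∈ray zeroLift S
zeroLift-∈ray S A A≋lift (c , 0≤c , A≋cS) = c , 0≤c , λ J J≢∅ → to≈ℝ (begin
  A J J≢∅                      ≈⟨ ⟨ A≋lift J J≢∅ ⟩ ⟩
  zeroLift (project A) J J≢∅   ≈⟨ zeroLift-elim J J≢∅ (λ value → value (project A) ≈ c *ℝ value S)
                                    (λ I≢∅ → ⟨ A≋cS (init J) I≢∅ ⟩)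
                                    (λ _ → pointwise-≈ λ k → sym (ℚ.*-zeroʳ (seq c k))) ⟩
  c *ℝ zeroLift S J J≢∅        ∎)
  where open ≈-Reasoning

-- Bridges the opaque `_+_` of the calculations and the transparent `_+ℝ_` inside `_⊕_`.
+≈⊕ : ∀ {n} (A B : Vector n) I .(I≢∅ : Nonempty I) → A I I≢∅ + B I I≢∅ ≈ (A ⊕ B) I I≢∅
+≈⊕ A B I I≢∅ = +≈+ℝ (A I I≢∅) (B I I≢∅)

≋-project : ∀ {n} (S : Vector n) T → zeroLift S ≋ T → S ≋ project T
≋-project S T S′≋T I I≢∅ = to≈ℝ (begin
  S I I≢∅                      ≈⟨ ⟨ project-zeroLift S I I≢∅ ⟩ ⟨
  project (zeroLift S) I I≢∅   ≈⟨ ⟨ S′≋T (I ∷ʳ outside) (Nonempty-∷ʳ outside I≢∅) ⟩ ⟩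
  project T I I≢∅              ∎)
  where open ≈-Reasoning

≋-project-⊕ : ∀ {n} (S : Vector n) A B → zeroLift S ≋ A ⊕ B → S ≋ project A ⊕ project B
≋-project-⊕ S A B S′≋A⊕B I I≢∅ = to≈ℝ (begin
  S I I≢∅                             ≈⟨ ⟨ ≋-project S (A ⊕ B) S′≋A⊕B I I≢∅ ⟩ ⟩
  project (A ⊕ B) I I≢∅               ≈⟨ +≈⊕ A B (I ∷ʳ outside) (Nonempty-∷ʳ outside I≢∅) ⟨
  project A I I≢∅ + project B I I≢∅   ≈⟨ +≈⊕ (project A) (project B) I I≢∅ ⟩
  (project A ⊕ project B) I I≢∅       ∎)
  where open ≈-Reasoning

summand-lastCoordinate : ∀ {n} (S : Vector n) A B → zeroLift S ≋ A ⊕ B →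
  lastCoordinate A + lastCoordinate B ≈ 0ℝ
summand-lastCoordinate {n} S A B S′≋A⊕B = begin
  lastCoordinate A + lastCoordinate B   ≈⟨ +≈⊕ A B (⊥ ∷ʳ inside) (Nonempty-⊥∷ʳinside n) ⟩
  lastCoordinate (A ⊕ B)                ≈⟨ ⟨ S′≋A⊕B (⊥ ∷ʳ inside) (Nonempty-⊥∷ʳinside n) ⟩ ⟨
  lastCoordinate (zeroLift S)           ≈⟨ zeroLift-lastCoordinate S ⟩
  0ℝ                                    ∎
  where open ≈-Reasoning

-- Extremality of the zero-lift and the projection of the cone.

zeroLift-extremeRay : ∀ {n} (S : Vector n) → IsExtremeRay (H n) S →
                      IsExtremeRay (H (suc n)) (zeroLift S)
zeroLift-extremeRay {n} S S-ray = record
  { member  = H-zeroLift S (member S-ray)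
  -- Projecting a vanishing zero-lift would make `S` vanish, as `project 𝟎` is `𝟎` by computation.
  ; nonzero = λ S′≋𝟎 → nonzero S-ray (≋-project S 𝟎 S′≋𝟎)
  ; extreme = λ A B A∈H B∈H S′≋A⊕B →
      let a+b≈0 = summand-lastCoordinate S A B S′≋A⊕B
          0≤a = H-nonneg A A∈H (⊥ ∷ʳ inside) (Nonempty-⊥∷ʳinside n)
          0≤b = H-nonneg B B∈H (⊥ ∷ʳ inside) (Nonempty-⊥∷ʳinside n)
          -- Nonnegative numbers with sum zero both vanish.
          a≈0 = x+y≈0⇒x≈0 0≤a 0≤b a+b≈0
          b≈0 = x+y≈0⇒x≈0 0≤b 0≤a (≈-trans (+-comm (lastCoordinate B) (lastCoordinate A)) a+b≈0)
          A-ray , B-ray = extreme S-ray (project A) (project B) (H-project A A∈H) (H-project B B∈H)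
                            (≋-project-⊕ S A B S′≋A⊕B)
      in zeroLift-∈ray S A (H-zeroLift-project A A∈H a≈0) A-ray
       , zeroLift-∈ray S B (H-zeroLift-project B B∈H b≈0) B-ray
  }
  where open IsExtremeRay

proposition5 : (n : ℕ) → .{{_ : NonZero n}} →
    ((S : Vector n) → IsExtremeRay (H n) S → IsExtremeRay (H (suc n)) (zeroLift S))
    × ((T : Vector n) → H n T ⇔ Image project (H (suc n)) T)
proposition5 n = zeroLift-extremeRay , λ T → mk⇔
  -- The zero-lift serves as the preimage.
  (λ T∈H → zeroLift T , H-zeroLift T T∈H , project-zeroLift T)
  -- The projection agrees with `T` only up to `_≋_`, so membership has to be transported.
  (λ (S , S∈H , S≋T) → H-cong (project S) T S≋T (H-project S S∈H))
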